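{- Let $(\mathcal M_*,\mathcal M_{\le\omega})$ be a Büchi abstraction (with maps $\alpha_*,\gamma_*,\alpha_{\le\omega},\gamma_{\le\omega}$) that is faithful with respect to a language $\mathfrak A\subseteq\Sigma^{\le\omega}$, i.e. $\gamma_{\le\omega}(\alpha_{\le\omega}(\mathfrak A))=\mathfrak A$. Given a Büchi method typing $M_{\mathfrak A}:\mathit{Sig}\to\mathcal M_*\langle\mathit{Reg}\rangle\times\mathcal M_*\langle\mathit{Sig}\rangle$, one can directly compute an assignment $\eta_{\mathfrak A}:\mathit{Sig}\to\mathcal M_{\le\omega}$ that abstracts the infinitary effect typing $\eta_\gamma:\mathit{Sig}\to\mathcal P(\Sigma^{\le\omega})$ for the concretized method typing $M_{\mathfrak A}^\gamma$; that is, for all $\delta\in\mathit{Sig}$, $$\eta_{\mathfrak A}(\delta)=\alpha_{\le\omega}(\eta_\gamma(\delta)),$$ where $\eta_\gamma$ is the greatest solution in $\mathcal P(\Sigma^{\le\omega})$ of the equation system $\{\delta=\gamma(\mathcal S_\delta)\mid\delta\in\mathit{Sig}\}$ and $\mathcal S_\delta$ is the call expression (second component) of $M_{\mathfrak A}(\delta)$.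
   Context: WORDS. $\Sigma$ is a finite alphabet, $\Sigma^*$ the finite words ($\varepsilon$ the empty word), $\Sigma^{\le\omega}$ the finite and infinite words; $U\cdot V=\{uv\mid u\in U,v\in V\}$ for $U\subseteq\Sigma^*$ and $V\subseteq\Sigma^*$ or $V\subseteq\Sigma^{\le\omega}$; $U^\omega=\{u_1u_2\cdots\mid u_i\in U\}\subseteq\Sigma^{\le\omega}$. $\mathcal P$ is powerset. SIGNATURES. For a Featherweight Java program with classes $\mathit{Cls}$, methods $\mathit{Mtd}$ and finitely many object-creation labels $\ell$, the regions are $\mathit{Reg}\ni r::=\mathtt{Null}\mid\mathtt{CreatedAt}(\ell)\mid\mathtt{Unknown}$. A method signature is a tuple $(C,r,m,\bar s)$ of a class $C$, a region $r$, a method $m$ of $C$, and a list $\bar s$ of regions, one per argument of $m$; $\mathit{Sig}\subseteq\mathit{Cls}\times\mathit{Reg}\times\mathit{Mtd}\times\mathit{Reg}^*$ is the (finite) set of method signatures. BÜCHI ABSTRACTION. A Büchi algebra is a pair of join-semilattices $(\mathcal M_*,\mathcal M_{\le\omega})$ (order $\sqsubseteq$, join $\sqcup$) with monotone operations $\cdot:\mathcal M_*\times\mathcal M_*\to\mathcal M_*$, $\cdot:\mathcal M_*\times\mathcal M_{\le\omega}\to\mathcal M_{\le\omega}$, $(-)^\omega:\mathcal M_*\to\mathcal M_{\le\omega}$, with $\mathcal A\cdot(\mathcal B\cdot\mathcal U)=(\mathcal A\cdot\mathcal B)\cdot\mathcal U$ for $\mathcal A,\mathcal B\in\mathcal M_*$,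 $\mathcal U\in\mathcal M_*\cup\mathcal M_{\le\omega}$. A Galois insertion between partial orders $A$ and $C$ consists of monotone $\alpha:C\to A$, $\gamma:A\to C$ with $\alpha(\gamma(a))=a$ and $\gamma(\alpha(c))\sqsupseteq c$. A Büchi abstraction is a finite Büchi algebra with Galois insertions $(\alpha_*,\gamma_*)$ between $\mathcal M_*$ and $\mathcal P(\Sigma^*)$ and $(\alpha_{\le\omega},\gamma_{\le\omega})$ between $\mathcal M_{\le\omega}$ and $\mathcal P(\Sigma^{\le\omega})$ such that $\alpha_*(A\cdot B)=\alpha_*(A)\cdot\alpha_*(B)$, $\alpha_{\le\omega}(A\cdot V)=\alpha_*(A)\cdot\alpha_{\le\omega}(V)$, $\alpha_{\le\omega}(A^\omega)=\alpha_*(A)^\omega$ for all $A,B\subseteq\Sigma^*$, $V\subseteq\Sigma^{\le\omega}$. EXPRESSIONS. For a set $K$, $\mathcal P(\Sigma^*)\langle K\rangle$ and $\mathcal M_*\langle K\rangle$ are the sets of finite partial functions from $K$ to $\mathcal P(\Sigma^*)$, resp. $\mathcal M_*$ (undefined entries treated as the empty set, resp. the least element). Elements of $\mathcal P(\Sigma^*)\langle\mathit{Sig}\rangle$ and $\mathcal M_*\langle\mathit{Sig}\rangle$ are call expressions, written $\bigcup_i U_i\cdot\delta_i$, resp. $\bigsqcup_i\mathcal A_i\cdot\delta_i$. For $\mathcal T\in\mathcal M_*\langle K\rangle$, $\gamma(\mathcal T)\in\mathcal P(\Sigma^*)\langle K\rangle$ is given by $\gamma(\mathcal T)(x)=\gamma_*(\mathcal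 T(x))$ for $x\in\mathrm{dom}(\mathcal T)$. $M_{\mathfrak A}^\gamma(\delta)=(\gamma(\mathcal T),\gamma(\mathcal S))$ if $M_{\mathfrak A}(\delta)=(\mathcal T,\mathcal S)$. For $S=\bigcup_iU_i\cdot\delta_i$ and $\eta:\mathit{Sig}\to\mathcal P(\Sigma^{\le\omega})$ put $S(\eta)=\bigcup_iU_i\cdot\eta(\delta_i)$. INFINITARY EFFECT TYPING. For a method typing $M:\mathit{Sig}\to\mathcal P(\Sigma^*)\langle\mathit{Reg}\rangle\times\mathcal P(\Sigma^*)\langle\mathit{Sig}\rangle$ with second components $S_\delta$, the infinitary effect typing for $M$ is the greatest (pointwise inclusion) $\eta:\mathit{Sig}\to\mathcal P(\Sigma^{\le\omega})$ with $\eta(\delta)=S_\delta(\eta)$ for all $\delta\in\mathit{Sig}$. A Büchi method typing is a map $M_{\mathfrak A}$ of the type given in the claim that is monotone in the class: $M_{\mathfrak A}(C,r,m,\bar s)\sqsubseteq M_{\mathfrak A}(D,r,m,\bar s)$ (componentwise, pointwise) whenever $C$ is a (reflexive, transitive) subclass of $D$ and $m$ is a method of $D$. -}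

module Defs where

open import Data.Fin using (Fin)
open import Data.Fin.Subset using (Subset; _∈_)
open import Data.List using (List; []; _∷_; _++_; length; concat; applyUpTo)
open import Data.Maybe as Maybe using (Maybe; just; fromMaybe)
open import Data.Nat using (ℕ; zero; suc)
open import Data.Product using (_×_; _,_; ∃-syntax; Σ-syntax; proj₁; proj₂)
open import Data.Sum using (_⊎_; inj₁; inj₂)
open import Data.Sum.Relation.Binary.Pointwise as Sumᵖ using (_⊎ₛ_)
open import Function using (_∘_)
open import Function.Bundles using (Inverse)
open import Level using (Level; 0ℓ) renaming (suc to lsuc)
open import Relation.Binary.Bundles using (Poset; Setoid)
open import Relation.Binary.Core using (Rel; _Preserves_⟶_; _Preserves₂_⟶_⟶_)
open import Relation.Binary.Definitions using (_Respects_)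
open import Relation.Binary.Lattice.Bundles using (BoundedJoinSemilattice)
open import Relation.Binary.Construct.Closure.ReflexiveTransitive using (Star)
open import Relation.Binary.Construct.Closure.Transitive using (TransClosure)
import Relation.Binary.Construct.On as On
open import Relation.Binary.PropositionalEquality as ≡ using (_≡_; refl; _→-setoid_)
open import Relation.Nullary using (¬_)
open import Relation.Unary using (Pred; ∅)
open import Relation.Unary.Relation.Binary.Subset using (⊆-poset)

private
  variable
    a ℓ : Level
    A   : Set

------------------------------------------------------------------------
-- Words and languages

-- Σ≤ω.  Infinite words are functions, so the equality of words is that of
-- lists on finite words and pointwise equality on infinite ones.
Word≤ω : Set → Setoid 0ℓ 0ℓ
Word≤ω A = ≡.setoid (List A) ⊎ₛ (ℕ →-setoid A)

Σ≤ω : Set → Set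
Σ≤ω A = Setoid.Carrier (Word≤ω A)

infix 4 _≈ʷ_
_≈ʷ_ : Rel (Σ≤ω A) 0ℓ
_≈ʷ_ {A} = Setoid._≈_ (Word≤ω A)

infixr 5 _++ω_ _++ʷ_

_++ω_ : List A → (ℕ → A) → ℕ → A
([]      ++ω f) n       = f n
((x ∷ u) ++ω f) zero    = x
((x ∷ u) ++ω f) (suc n) = (u ++ω f) n

_++ʷ_ : List A → Σ≤ω A → Σ≤ω A
u ++ʷ inj₁ v = inj₁ (u ++ v)
u ++ʷ inj₂ f = inj₂ (u ++ω f)

Lang* : Set → Set₁
Lang* A = Pred (List A) 0ℓ

-- A set of finite and infinite words cannot distinguish equal words.
record Lang≤ω (A : Set) : Set₁ where
  constructor lang
  field
    words : Pred (Σ≤ω A) 0ℓ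
    resp  : words Respects _≈ʷ_

open Lang≤ω public

infix 4 _∈ʷ_
_∈ʷ_ : Σ≤ω A → Lang≤ω A → Set
w ∈ʷ V = words V w

𝒫* : Set → Poset (lsuc 0ℓ) 0ℓ 0ℓ
𝒫* A = ⊆-poset (List A) 0ℓ

𝒫≤ω : Set → Poset (lsuc 0ℓ) 0ℓ 0ℓ
𝒫≤ω A = On.poset (⊆-poset (Σ≤ω A) 0ℓ) words

infix 4 _⊆ʷ_ _≐ʷ_

_⊆ʷ_ : Rel (Lang≤ω A) 0ℓ
_⊆ʷ_ {A} = Poset._≤_ (𝒫≤ω A)

_≐ʷ_ : Rel (Lang≤ω A) 0ℓ
_≐ʷ_ {A} = Poset._≈_ (𝒫≤ω A)

infixr 7 _·ˡ_ _·ʷ_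

_·ˡ_ : Lang* A → Lang* A → Lang* A
(U ·ˡ V) w = ∃[ u ] ∃[ v ] U u × V v × w ≡ u ++ v

_·ʷ_ : Lang* A → Lang≤ω A → Lang≤ω A
_·ʷ_ {A} U V = lang
  (λ w → ∃[ u ] ∃[ v ] U u × v ∈ʷ V × w ≈ʷ u ++ʷ v)
  (λ w≈w′ (u , v , u∈U , v∈V , eq) → u , v , u∈U , v∈V , W.trans (W.sym w≈w′) eq)
  where module W = Setoid (Word≤ω A)

Prefix : List A → Σ≤ω A → Set
Prefix p w = ∃[ v ] w ≈ʷ p ++ʷ v

prefix-resp : (p : List A) → Prefix p Respects _≈ʷ_
prefix-resp {A} p w≈w′ (v , eq) = v , W.trans (W.sym w≈w′) eq
  where module W = Setoid (Word≤ω A)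

partialProduct : (ℕ → List A) → ℕ → List A
partialProduct us n = concat (applyUpTo us n)

-- w = u₀u₁u₂⋯, i.e. w is the least upper bound, in the prefix order, of the
-- finite products u₀⋯uₙ₋₁.  In particular the product is finite exactly when
-- almost all factors are ε, and it is ε when all of them are.
IsInfiniteProduct : (ℕ → List A) → Σ≤ω A → Set
IsInfiniteProduct us w =
  (∀ n → Prefix (partialProduct us n) w) ×
  (∀ p → Prefix p w → ∃[ n ] Prefix p (inj₁ (partialProduct us n)))

infix 8 _^ωˡ
_^ωˡ : Lang* A → Lang≤ω A
_^ωˡ {A} U = lang
  (λ w → ∃[ us ] (∀ i → U (us i)) × IsInfiniteProduct us w)
  (λ w≈w′ (us , us∈U , below , least) →
     us , us∈U ,
     (λ n → prefix-resp (partialProduct us n) w≈w′ (below n)) ,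
     (λ p p⊑w′ → least p (prefix-resp p (W.sym w≈w′) p⊑w′)))
  where module W = Setoid (Word≤ω A)

------------------------------------------------------------------------
-- Büchi algebras and Büchi abstractions

-- Semilattices have a least element: it interprets the undefined entries of
-- partial functions into 𝓜*.
record BüchiAlgebra : Set₁ where
  field
    𝓜*  : BoundedJoinSemilattice 0ℓ 0ℓ 0ℓ
    𝓜≤ω : BoundedJoinSemilattice 0ℓ 0ℓ 0ℓ

  module M* = BoundedJoinSemilattice 𝓜*
  module Mω = BoundedJoinSemilattice 𝓜≤ω

  infixr 7 _·_ _·ω_
  infix  8 _^ω

  field
    _·_  : M*.Carrier → M*.Carrier → M*.Carrier
    _·ω_ : M*.Carrier → Mω.Carrier → Mω.Carrier
    _^ω  : M*.Carrier → Mω.Carrier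

    ·-mono  : _·_  Preserves₂ M*._≤_ ⟶ M*._≤_ ⟶ M*._≤_
    ·ω-mono : _·ω_ Preserves₂ M*._≤_ ⟶ Mω._≤_ ⟶ Mω._≤_
    ^ω-mono : _^ω  Preserves M*._≤_ ⟶ Mω._≤_

    ·-assoc  : ∀ x y z → x · (y · z) M*.≈ (x · y) · z
    ·ω-assoc : ∀ x y u → x ·ω (y ·ω u) Mω.≈ (x · y) ·ω u

Finite : Setoid a ℓ → Set _
Finite S = ∃[ n ] Inverse (≡.setoid (Fin n)) S

record FiniteBüchiAlgebra : Set₁ where
  field
    büchiAlgebra : BüchiAlgebra

  open BüchiAlgebra büchiAlgebra public

  field
    finite*  : Finite (Poset.Eq.setoid M*.poset)
    finite≤ω : Finite (Poset.Eq.setoid Mω.poset)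

record GaloisInsertion {a₁ a₂ a₃ c₁ c₂ c₃}
  (𝒜 : Poset a₁ a₂ a₃) (𝒞 : Poset c₁ c₂ c₃)
  : Set (a₁ Level.⊔ a₂ Level.⊔ a₃ Level.⊔ c₁ Level.⊔ c₂ Level.⊔ c₃) where
  private
    module 𝒜 = Poset 𝒜
    module 𝒞 = Poset 𝒞
  field
    α      : 𝒞.Carrier → 𝒜.Carrier
    γ      : 𝒜.Carrier → 𝒞.Carrier
    α-mono : α Preserves 𝒞._≤_ ⟶ 𝒜._≤_
    γ-mono : γ Preserves 𝒜._≤_ ⟶ 𝒞._≤_
    α∘γ    : ∀ x → α (γ x) 𝒜.≈ x
    γ∘α    : ∀ y → y 𝒞.≤ γ (α y)

record BüchiAbstraction (A : Set) (𝓑 : FiniteBüchiAlgebra) : Set₁ where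
  open FiniteBüchiAlgebra 𝓑
  field
    insertion*  : GaloisInsertion M*.poset (𝒫* A)
    insertion≤ω : GaloisInsertion Mω.poset (𝒫≤ω A)

  open GaloisInsertion insertion* public using () renaming (α to α*; γ to γ*)
  open GaloisInsertion insertion≤ω public using () renaming (α to α≤ω; γ to γ≤ω)

  field
    α*-·   : ∀ U V → α*  (U ·ˡ V) M*.≈ α* U · α* V
    α≤ω-·  : ∀ U V → α≤ω (U ·ʷ V) Mω.≈ α* U ·ω α≤ω V
    α≤ω-^ω : ∀ U   → α≤ω (U ^ωˡ)  Mω.≈ α* U ^ω

  Faithful : Lang≤ω A → Set
  Faithful 𝔄 = γ≤ω (α≤ω 𝔄) ≐ʷ 𝔄

------------------------------------------------------------------------
-- Programs, regions and method signatures

-- The part of a Featherweight Java program on which method signatures depend.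
-- A class without superclass is a root of the hierarchy (Object).
record Program : Set where
  field
    #classes #methods #labels : ℕ

  Cls : Set
  Cls = Fin #classes

  Mtd : Set
  Mtd = Fin #methods

  Label : Set
  Label = Fin #labels

  field
    superclass : Cls → Maybe Cls
    methods    : Cls → Subset #methods
    arity      : Cls → Mtd → ℕ

  Extends : Rel Cls 0ℓ
  Extends C D = superclass C ≡ just D

  infix 4 _≼_
  _≼_ : Rel Cls 0ℓ
  _≼_ = Star Extends

  field
    acyclic       : ∀ {C} → ¬ TransClosure Extends C C
    methods-inh   : ∀ {C D m} → C ≼ D → m ∈ methods D → m ∈ methods C
    arity-inh     : ∀ {C D m} → C ≼ D → m ∈ methods D → arity C m ≡ arity D m

module Signatures (P : Program) where
  open Program P

  data Reg : Set where
    Null      : Reg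
    CreatedAt : Label → Reg
    Unknown   : Reg

  -- The side conditions are irrelevant, so that signatures are determined by
  -- the underlying tuples.
  record Sig : Set where
    constructor sig
    field
      cls       : Cls
      region    : Reg
      mtd       : Mtd
      args      : List Reg
      .isMethod : mtd ∈ methods cls
      .perArg   : length args ≡ arity cls mtd

------------------------------------------------------------------------
-- Partial functions

-- Used only for finite K (regions and signatures of a program), so that every
-- partial function is finite.
infix 9 _⟨_⟩
_⟨_⟩ : Set ℓ → Set → Set ℓ
X ⟨ K ⟩ = K → Maybe X

------------------------------------------------------------------------
-- Method typings

module Typing (P : Program) where
  open Program P
  open Signatures P

  TypingOver : Set ℓ → Set ℓ
  TypingOver X = Sig → X ⟨ Reg ⟩ × X ⟨ Sig ⟩

  MethodTyping : Set → Set₁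
  MethodTyping A = TypingOver (Lang* A)

  -- S(η) = ⋃ᵢ Uᵢ · η(δᵢ)
  eval : Lang* A ⟨ Sig ⟩ → (Sig → Lang≤ω A) → Lang≤ω A
  eval S η = lang
    (λ w → ∃[ δ ] w ∈ʷ fromMaybe ∅ (S δ) ·ʷ η δ)
    (λ { w≈w′ (δ , w∈) → δ , resp (fromMaybe ∅ (S δ) ·ʷ η δ) w≈w′ w∈ })

  IsSolution : MethodTyping A → (Sig → Lang≤ω A) → Set
  IsSolution M η = ∀ δ → η δ ≐ʷ eval (proj₂ (M δ)) η

  record IsInfinitaryEffectTyping (M : MethodTyping A) (η : Sig → Lang≤ω A) : Set₁ where
    field
      isSolution : IsSolution M η
      isGreatest : ∀ η′ → IsSolution M η′ → ∀ δ → η′ δ ⊆ʷ η δ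

  -- Every method typing has an infinitary effect typing: w belongs to it at δ
  -- when there is an infinite run of unfoldings of the equations from (δ , w).
  module Existence {A : Set} (M : MethodTyping A) where
    private
      module W = Setoid (Word≤ω A)

      U : Sig → Sig → Lang* A
      U δ δ′ = fromMaybe ∅ (proj₂ (M δ) δ′)

    record Run (δ : Sig) (w : Σ≤ω A) : Set where
      field
        δs    : ℕ → Sig
        us    : ℕ → List A
        ws    : ℕ → Σ≤ω A
        δs₀   : δs 0 ≡ δ
        ws₀   : w ≈ʷ ws 0
        us∈   : ∀ n → U (δs n) (δs (suc n)) (us n)
        steps : ∀ n → ws n ≈ʷ us n ++ʷ ws (suc n)

    greatest : Sig → Lang≤ω A
    greatest δ = lang (Run δ) λ w≈w′ r → record
      { Run r ; ws₀ = W.trans (W.sym w≈w′) (Run.ws₀ r) }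

    private
      unfold : ∀ δ → greatest δ ⊆ʷ eval (proj₂ (M δ)) greatest
      unfold δ {w} r =
        δs 1 , us 0 , ws 1 ,
        ≡.subst (λ δ″ → U δ″ (δs 1) (us 0)) δs₀ (us∈ 0) , tail , W.trans ws₀ (steps 0)
        where
        open Run r
        tail : Run (δs 1) (ws 1)
        tail = record
          { δs = δs ∘ suc ; us = us ∘ suc ; ws = ws ∘ suc
          ; δs₀ = refl ; ws₀ = W.refl {ws 1}
          ; us∈ = us∈ ∘ suc ; steps = steps ∘ suc }

      fold : ∀ δ → eval (proj₂ (M δ)) greatest ⊆ʷ greatest δ
      fold δ {w} (δ′ , u , v , u∈ , r , eq) = record
        { δs = λ { zero → δ ; (suc n) → δs n }
        ; us = λ { zero → u ; (suc n) → us n }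
        ; ws = λ { zero → w ; (suc n) → ws n }
        ; δs₀ = refl
        ; ws₀ = W.refl {w}
        ; us∈ = λ { zero → ≡.subst (λ δ″ → U δ δ″ u) (≡.sym δs₀) u∈ ; (suc n) → us∈ n }
        ; steps = λ { zero → W.trans eq (++ʷ-congʳ u ws₀) ; (suc n) → steps n } }
        where
        open Run r
        ++ω-cong : ∀ p {f g : ℕ → A} → (∀ n → f n ≡ g n) → ∀ n → (p ++ω f) n ≡ (p ++ω g) n
        ++ω-cong []      f≗g n       = f≗g n
        ++ω-cong (x ∷ p) f≗g zero    = refl
        ++ω-cong (x ∷ p) f≗g (suc n) = ++ω-cong p f≗g n
        ++ʷ-congʳ : ∀ p {x y : Σ≤ω A} → x ≈ʷ y → p ++ʷ x ≈ʷ p ++ʷ y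
        ++ʷ-congʳ p (Sumᵖ.inj₁ eq₁) = Sumᵖ.inj₁ (≡.cong (p ++_) eq₁)
        ++ʷ-congʳ p (Sumᵖ.inj₂ eq₂) = Sumᵖ.inj₂ (++ω-cong p eq₂)

      module _ (η : Sig → Lang≤ω A) (sol : IsSolution M η) where
        State : Set
        State = Σ[ δ ∈ Sig ] Σ[ w ∈ Σ≤ω A ] w ∈ʷ η δ

        next : State → State
        next (δ , w , w∈) with proj₁ (sol δ) w∈
        ... | δ′ , u , v , u∈ , v∈ , eq = δ′ , v , v∈

        factor : State → List A
        factor (δ , w , w∈) = proj₁ (proj₂ (proj₁ (sol δ) w∈))

        states : State → ℕ → State
        states s zero    = s
        states s (suc n) = next (states s n)

        factor∈ : ∀ s → U (proj₁ s) (proj₁ (next s)) (factor s)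
        factor∈ (δ , w , w∈) with proj₁ (sol δ) w∈
        ... | δ′ , u , v , u∈ , v∈ , eq = u∈

        factorises : ∀ s → proj₁ (proj₂ s) ≈ʷ factor s ++ʷ proj₁ (proj₂ (next s))
        factorises (δ , w , w∈) with proj₁ (sol δ) w∈
        ... | δ′ , u , v , u∈ , v∈ , eq = eq

        run : ∀ δ → η δ ⊆ʷ greatest δ
        run δ {w} w∈ = record
          { δs = proj₁ ∘ states s ; us = factor ∘ states s
          ; ws = proj₁ ∘ proj₂ ∘ states s
          ; δs₀ = refl ; ws₀ = W.refl {w}
          ; us∈ = factor∈ ∘ states s ; steps = factorises ∘ states s }
          where s = δ , w , w∈

    isInfinitaryEffectTyping : IsInfinitaryEffectTyping M greatest
    isInfinitaryEffectTyping = record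
      { isSolution = λ δ → unfold δ , fold δ
      ; isGreatest = run }

  module _ (𝓑 : FiniteBüchiAlgebra) where
    open FiniteBüchiAlgebra 𝓑

    _⊑_ : {K : Set} → Rel (M*.Carrier ⟨ K ⟩) 0ℓ
    𝒯 ⊑ 𝒯′ = ∀ x → fromMaybe M*.⊥ (𝒯 x) M*.≤ fromMaybe M*.⊥ (𝒯′ x)

    record BüchiMethodTyping : Set where
      field
        typing : TypingOver M*.Carrier
        mono   : ∀ {C D r m s̄} .{m∈C : m ∈ methods C} .{m∈D : m ∈ methods D}
                 .{lenC : length s̄ ≡ arity C m} .{lenD : length s̄ ≡ arity D m} →
                 C ≼ D →
                 let (𝒯 , 𝒮)   = typing (sig C r m s̄ m∈C lenC)
                     (𝒯′ , 𝒮′) = typing (sig D r m s̄ m∈D lenD)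
                 in (𝒯 ⊑ 𝒯′) × (𝒮 ⊑ 𝒮′)

  -- The entry at x is γ* of the entry of 𝒯 where 𝒯 is defined, and undefined
  -- elsewhere; γ* of the least element need not be empty.
  γ⟨_⟩ : ∀ {𝓑} (𝔟 : BüchiAbstraction A 𝓑) {K : Set} →
         BoundedJoinSemilattice.Carrier (FiniteBüchiAlgebra.𝓜* 𝓑) ⟨ K ⟩ → Lang* A ⟨ K ⟩
  γ⟨ 𝔟 ⟩ 𝒯 x = Maybe.map (BüchiAbstraction.γ* 𝔟) (𝒯 x)

  concretize : ∀ {𝓑} → BüchiAbstraction A 𝓑 → BüchiMethodTyping 𝓑 → MethodTyping A
  concretize 𝔟 M δ =
    let (𝒯 , 𝒮) = BüchiMethodTyping.typing M δ in γ⟨ 𝔟 ⟩ 𝒯 , γ⟨ 𝔟 ⟩ 𝒮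

{-# OPTIONS --safe #-}

-- By the pigeonhole principle a run of the equations visits some signature δ′
-- infinitely often.  If infinitely many of its factors are nonempty, its word
-- lies in P·L^ω, where P is the language of the paths to δ′ and L that of the
-- nontrivial loops at δ′; otherwise ε is produced for ever from some δ′ on, the
-- rest of the word is arbitrary, and the word lies in P·Σ^≤ω.  Conversely, the
-- union of these languages solves the equations.  Since α commutes with unions,
-- products and ω-powers, it remains to compute α(P) and α(L), as least fixed
-- points in the finite algebra, and to decide where ε can be produced for ever:
-- ε ∈ γ(a) iff e ⊑ a, where e = α{ε} is the only left unit of the algebra.

module Submission where

open import Defs
open import Axiom.ExcludedMiddle using (ExcludedMiddle)
open import Data.Bool as Bool using (Bool; true; false; not; b≤b; f≤t)
open import Data.Bool.ListAction using (all)
import Data.Bool.Properties as Boolₚ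
open import Data.Fin as Fin using (Fin; toℕ)
import Data.Fin.Properties as Finₚ
import Data.Fin.Subset.Properties as Subsetₚ
open import Data.List
  using (List; []; _∷_; [_]; _++_; allFin; cartesianProductWith; concatMap; length; lookup; map)
open import Data.List.Membership.Propositional using (_∈_; _∉_; lose)
open import Data.List.Membership.Propositional.Properties
  using (∈-allFin; ∈-cartesianProductWith⁺; ∈-concatMap⁺; ∈-map⁺)
open import Data.List.Properties
  using (++-assoc; ++-conicalˡ; ++-conicalʳ; ++-identityʳ; length-++; ∷-injective)
open import Data.List.Relation.Unary.Any as Any using (here; there)
import Data.List.Relation.Unary.Any.Properties as Anyₚ
open import Data.Maybe as Maybe using (just; nothing; fromMaybe)
open import Data.Nat as ℕ
  using (ℕ; zero; suc; _+_; _^_; _⊔_; _≤‴_; ≤‴-refl; ≤‴-step; z≤n; s≤s)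
import Data.Nat.Properties as ℕₚ
open import Data.Product using (_×_; _,_; ∃-syntax; Σ-syntax; map₂; proj₁; proj₂)
open import Data.Sum using (_⊎_; inj₁; inj₂)
import Data.Sum.Relation.Binary.Pointwise as Sumᵖ
open import Data.Unit using (⊤)
open import Function using (_∘_; const)
open import Function.Bundles using (Inverse)
open import Level using (0ℓ)
open import Relation.Binary.Bundles using (Poset; Setoid)
open import Relation.Binary.Definitions using (Decidable; DecidableEquality; Minimum)
open import Relation.Binary.Lattice.Bundles using (BoundedJoinSemilattice)
open import Relation.Binary.PropositionalEquality as ≡ using (_≡_; _≢_; refl; cong)
open import Relation.Nullary using (¬_; Dec; Reflects; does; invert; no; proof; yes)
open import Relation.Nullary.Decidable using (dec-true; map′; recompute)
open import Relation.Nullary.Negation using (contradiction)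
open import Relation.Unary using (∅)

-- Words

module Words {A : Set} where
  open Setoid (Word≤ω A) public using ()
    renaming (refl to ≈ʷ-refl; sym to ≈ʷ-sym; trans to ≈ʷ-trans)

  ++ω-cong : ∀ p {f g : ℕ → A} → (∀ n → f n ≡ g n) → ∀ n → (p ++ω f) n ≡ (p ++ω g) n
  ++ω-cong []      f≗g n       = f≗g n
  ++ω-cong (x ∷ p) f≗g zero    = refl
  ++ω-cong (x ∷ p) f≗g (suc n) = ++ω-cong p f≗g n

  ++ʷ-cong : ∀ p {x y : Σ≤ω A} → x ≈ʷ y → p ++ʷ x ≈ʷ p ++ʷ y
  ++ʷ-cong p (Sumᵖ.inj₁ eq) = Sumᵖ.inj₁ (cong (p ++_) eq)
  ++ʷ-cong p (Sumᵖ.inj₂ eq) = Sumᵖ.inj₂ (++ω-cong p eq)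

  ++ω-assoc : ∀ p q (f : ℕ → A) n → ((p ++ q) ++ω f) n ≡ (p ++ω (q ++ω f)) n
  ++ω-assoc []      q f n       = refl
  ++ω-assoc (x ∷ p) q f zero    = refl
  ++ω-assoc (x ∷ p) q f (suc n) = ++ω-assoc p q f n

  ++ʷ-assoc : ∀ p q (x : Σ≤ω A) → (p ++ q) ++ʷ x ≈ʷ p ++ʷ (q ++ʷ x)
  ++ʷ-assoc p q (inj₁ r) = Sumᵖ.inj₁ (++-assoc p q r)
  ++ʷ-assoc p q (inj₂ f) = Sumᵖ.inj₂ (++ω-assoc p q f)

  []-++ʷ : ∀ (x : Σ≤ω A) → [] ++ʷ x ≈ʷ x
  []-++ʷ (inj₁ r) = ≈ʷ-refl
  []-++ʷ (inj₂ f) = ≈ʷ-refl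

  ∷-++ʷ-injective : ∀ {a b p q} (x y : Σ≤ω A) → (a ∷ p) ++ʷ x ≈ʷ (b ∷ q) ++ʷ y →
                    a ≡ b × p ++ʷ x ≈ʷ q ++ʷ y
  ∷-++ʷ-injective (inj₁ _) (inj₁ _) (Sumᵖ.inj₁ eq)   = map₂ Sumᵖ.inj₁ (∷-injective eq)
  ∷-++ʷ-injective (inj₂ _) (inj₂ _) (Sumᵖ.inj₂ eq)   = eq 0 , Sumᵖ.inj₂ (eq ∘ suc)

  ++ʷ-cancelˡ : ∀ p {x y : Σ≤ω A} → p ++ʷ x ≈ʷ p ++ʷ y → x ≈ʷ y
  ++ʷ-cancelˡ []      {x} {y} eq = ≈ʷ-trans (≈ʷ-sym ([]-++ʷ x)) (≈ʷ-trans eq ([]-++ʷ y))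
  ++ʷ-cancelˡ (a ∷ p) {x} {y} eq = ++ʷ-cancelˡ p (proj₂ (∷-++ʷ-injective x y eq))

  prefix-linear : ∀ p q {x y : Σ≤ω A} → p ++ʷ x ≈ʷ q ++ʷ y → length p ℕ.≤ length q →
                  Prefix p (inj₁ q)
  prefix-linear []      q       eq _ = inj₁ q , ≈ʷ-refl
  prefix-linear (a ∷ p) (b ∷ q) {x} {y} eq (s≤s p≤q)
    with ∷-++ʷ-injective x y eq
  ... | refl , eq′ with prefix-linear p q eq′ p≤q
  ... | inj₁ r , Sumᵖ.inj₁ eq″ = inj₁ r , Sumᵖ.inj₁ (cong (a ∷_) eq″)

  infiniteProduct-tail : ∀ us {w : Σ≤ω A} → IsInfiniteProduct us w →
    ∃[ t ] w ≈ʷ us 0 ++ʷ t × IsInfiniteProduct (us ∘ suc) t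
  infiniteProduct-tail us {w} (below , least) = t , w≈ , below′ , least′
    where
    t = proj₁ (below 1)

    w≈ : w ≈ʷ us 0 ++ʷ t
    w≈ = ≈ʷ-trans (proj₂ (below 1))
           (≈ʷ-trans (++ʷ-assoc (us 0) [] t) (++ʷ-cong (us 0) ([]-++ʷ t)))

    below′ : ∀ n → Prefix (partialProduct (us ∘ suc) n) t
    below′ n with below (suc n)
    ... | x , eq = x , ++ʷ-cancelˡ (us 0)
          (≈ʷ-trans (≈ʷ-sym w≈) (≈ʷ-trans eq (++ʷ-assoc (us 0) _ x)))

    least′ : ∀ p → Prefix p t → ∃[ n ] Prefix p (inj₁ (partialProduct (us ∘ suc) n))
    least′ p (x , t≈)
      with least (us 0 ++ p)
             (x , ≈ʷ-trans w≈ (≈ʷ-trans (++ʷ-cong (us 0) t≈) (≈ʷ-sym (++ʷ-assoc (us 0) p x))))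
    ... | suc n , y , eq = n , y , ++ʷ-cancelˡ (us 0) (≈ʷ-trans eq (++ʷ-assoc (us 0) p y))
    ... | zero , inj₁ r , Sumᵖ.inj₁ eq
      with p | ++-conicalʳ (us 0) p (++-conicalˡ (us 0 ++ p) r (≡.sym eq))
    ... | .[] | refl = 0 , inj₁ [] , ≈ʷ-refl

  partialProduct-prefix : ∀ vs (xs : ℕ → Σ≤ω A) → (∀ n → xs n ≈ʷ vs n ++ʷ xs (suc n)) →
                          ∀ n → xs 0 ≈ʷ partialProduct vs n ++ʷ xs n
  partialProduct-prefix vs xs step zero    = ≈ʷ-sym ([]-++ʷ (xs 0))
  partialProduct-prefix vs xs step (suc n) =
    ≈ʷ-trans (step 0)
      (≈ʷ-trans (++ʷ-cong (vs 0) (partialProduct-prefix (vs ∘ suc) (xs ∘ suc) (step ∘ suc) n))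
        (≈ʷ-sym (++ʷ-assoc (vs 0) _ (xs (suc n)))))

  length-partialProduct : ∀ (vs : ℕ → List A) → (∀ n → 0 ℕ.< length (vs n)) →
                          ∀ n → n ℕ.≤ length (partialProduct vs n)
  length-partialProduct vs 0<vs zero    = z≤n
  length-partialProduct vs 0<vs (suc n) = begin
    suc n
      ≤⟨ ℕₚ.+-mono-≤ (0<vs 0) (length-partialProduct (vs ∘ suc) (0<vs ∘ suc) n) ⟩
    length (vs 0) + length (partialProduct (vs ∘ suc) n)
      ≡⟨ length-++ (vs 0) ⟨
    length (partialProduct vs (suc n)) ∎
    where open ℕₚ.≤-Reasoning

  isInfiniteProduct : ∀ vs (xs : ℕ → Σ≤ω A) → (∀ n → xs n ≈ʷ vs n ++ʷ xs (suc n)) →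
                      (∀ n → 0 ℕ.< length (vs n)) → IsInfiniteProduct vs (xs 0)
  isInfiniteProduct vs xs step 0<vs =
    (λ n → xs n , prefix n) ,
    (λ p (x , eq) → length p ,
       prefix-linear p (partialProduct vs (length p))
         (≈ʷ-trans (≈ʷ-sym eq) (prefix (length p)))
         (length-partialProduct vs 0<vs (length p)))
    where prefix = partialProduct-prefix vs xs step

-- Finite orders

module FiniteSetoid (S : Setoid 0ℓ 0ℓ) (finite : Finite S) where
  open Setoid S
  open Inverse (proj₂ finite) public using (to; from; from-cong)

  size : ℕ
  size = proj₁ finite

  to∘from : ∀ x → to (from x) ≈ x
  to∘from = Inverse.strictlyInverseˡ (proj₂ finite)

  from-injective : ∀ {x y} → from x ≡ from y → x ≈ y
  from-injective {x} {y} eq =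
    trans (sym (to∘from x)) (trans (reflexive (cong to eq)) (to∘from y))

  infix 4 _≟_
  _≟_ : Decidable _≈_
  x ≟ y = map′ from-injective from-cong (from x Finₚ.≟ from y)

module Joins (L : BoundedJoinSemilattice 0ℓ 0ℓ 0ℓ) where
  open BoundedJoinSemilattice L renaming (refl to ≤-refl)

  ⋁ : {I : Set} → List I → (I → Carrier) → Carrier
  ⋁ []       f = ⊥
  ⋁ (i ∷ is) f = f i ∨ ⋁ is f

  ⋁-upper : ∀ {I : Set} {is : List I} f {i} → i ∈ is → f i ≤ ⋁ is f
  ⋁-upper f (here refl) = x≤x∨y _ _
  ⋁-upper f (there i∈)  = trans (⋁-upper f i∈) (y≤x∨y _ _)

  ⋁-least : ∀ {I : Set} (is : List I) f {x} → (∀ i → f i ≤ x) → ⋁ is f ≤ x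
  ⋁-least []       f f≤x = minimum _
  ⋁-least (i ∷ is) f f≤x = ∨-least (f≤x i) (⋁-least is f f≤x)

  ∨-mono : ∀ {x y x′ y′} → x ≤ x′ → y ≤ y′ → x ∨ y ≤ x′ ∨ y′
  ∨-mono x≤ y≤ = ∨-least (trans x≤ (x≤x∨y _ _)) (trans y≤ (y≤x∨y _ _))

  ⋁-mono : ∀ {I : Set} (is : List I) {f g} → (∀ i → f i ≤ g i) → ⋁ is f ≤ ⋁ is g
  ⋁-mono []       f≤g = ≤-refl
  ⋁-mono (i ∷ is) f≤g = ∨-mono (f≤g i) (⋁-mono is f≤g)

  module _ (finite : Finite (Poset.Eq.setoid poset)) where
    open FiniteSetoid (Poset.Eq.setoid poset) finite

    infix 4 _≤?_
    _≤?_ : Decidable _≤_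
    x ≤? y = map′ (λ eq → trans (x≤x∨y x y) (reflexive eq))
                  (λ x≤y → antisym (∨-least x≤y ≤-refl) (y≤x∨y x y))
                  (x ∨ y ≟ y)

    top : Carrier
    top = ⋁ (allFin size) to

    top-maximum : ∀ x → x ≤ top
    top-maximum x =
      trans (reflexive (Eq.sym (to∘from x))) (⋁-upper to (∈-allFin (from x)))

module LeastFixedPoint
  (P : Poset 0ℓ 0ℓ 0ℓ) (finite : Finite (Poset.Eq.setoid P))
  (⊥ : Poset.Carrier P) (⊥-minimum : Minimum (Poset._≤_ P) ⊥)
  {I : Set} {m : ℕ} (index : I → Fin m) (elem : Fin m → I)
  (elem∘index : ∀ i → elem (index i) ≡ i)
  where
  open Poset P
  open FiniteSetoid Eq.setoid finite

  infix 4 _≤̇_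
  _≤̇_ : (I → Carrier) → (I → Carrier) → Set
  f ≤̇ g = ∀ i → f i ≤ g i

  module _ (F : (I → Carrier) → I → Carrier)
           (F-mono : ∀ {f g} → f ≤̇ g → F f ≤̇ F g) where

    iterate : ℕ → I → Carrier
    iterate zero    = const ⊥
    iterate (suc n) = F (iterate n)

    lfp : I → Carrier
    lfp = iterate (size ^ m)

    iterate-least : ∀ {f} → F f ≤̇ f → ∀ n → iterate n ≤̇ f
    iterate-least F≤ zero    i = ⊥-minimum _
    iterate-least F≤ (suc n) i = trans (F-mono (iterate-least F≤ n) i) (F≤ i)

    lfp-least : ∀ {f} → F f ≤̇ f → lfp ≤̇ f
    lfp-least F≤ = iterate-least F≤ (size ^ m)

    iterate-mono : ∀ {j k} → j ℕ.≤ k → iterate j ≤̇ iterate k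
    iterate-mono {zero}  {k}     _           i = ⊥-minimum _
    iterate-mono {suc j} {suc k} (s≤s j≤k) i = F-mono (iterate-mono j≤k) i

    code : (I → Carrier) → Fin (size ^ m)
    code f = Fin.funToFin (from ∘ f ∘ elem)

    code-≡⇒≥ : ∀ {f g} → code f ≡ code g → g ≤̇ f
    code-≡⇒≥ {f} {g} eq i = reflexive (Eq.sym (≡.subst (λ i → f i ≈ g i) (elem∘index i)
      (from-injective (begin
        from (f (elem (index i)))              ≡⟨ Finₚ.finToFun-funToFin (from ∘ f ∘ elem) (index i) ⟨
        Fin.finToFun {size} (code f) (index i) ≡⟨ cong (λ c → Fin.finToFun {size} c (index i)) eq ⟩
        Fin.finToFun {size} (code g) (index i) ≡⟨ Finₚ.finToFun-funToFin (from ∘ g ∘ elem) (index i) ⟩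
        from (g (elem (index i)))              ∎))))
      where open ≡.≡-Reasoning

    -- There are only size ^ m maps from I, so two of the first size ^ m + 1 iterates
    -- coincide; since the iterates ascend, they are constant from there on.
    lfp-prefixed : F lfp ≤̇ lfp
    lfp-prefixed i
      with Finₚ.pigeonhole (ℕₚ.n<1+n (size ^ m)) (code ∘ iterate ∘ toℕ)
    ... | j , k , j<k , eq =
      trans (iterate-least F-iterate-j≤ (suc (size ^ m)) i)
            (iterate-mono (ℕ.s≤s⁻¹ (Finₚ.toℕ<n j)) i)
      where
      F-iterate-j≤ : F (iterate (toℕ j)) ≤̇ iterate (toℕ j)
      F-iterate-j≤ i = trans (iterate-mono j<k i) (code-≡⇒≥ eq i)

module Listed {V : Set} (vertices : List V) (∈-vertices : ∀ x → x ∈ vertices) where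

  index : V → Fin (length vertices)
  index x = Any.index (∈-vertices x)

  lookup-index : ∀ x → lookup vertices (index x) ≡ x
  lookup-index x = ≡.sym (Anyₚ.lookup-index (∈-vertices x))

  infix 4 _≟_
  _≟_ : DecidableEquality V
  x ≟ y = map′
    (λ eq → ≡.trans (≡.sym (lookup-index x)) (≡.trans (cong (lookup vertices) eq) (lookup-index y)))
    (cong index) (index x Finₚ.≟ index y)

∧-mono : ∀ {a b c d} → a Bool.≤ b → c Bool.≤ d → a Bool.∧ c Bool.≤ b Bool.∧ d
∧-mono f≤t         c≤d = Boolₚ.≤-minimum _
∧-mono {true}  b≤b c≤d = c≤d
∧-mono {false} b≤b c≤d = b≤b

∨-monoʳ : ∀ a {c d} → c Bool.≤ d → a Bool.∨ c Bool.≤ a Bool.∨ d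
∨-monoʳ true  c≤d = b≤b
∨-monoʳ false c≤d = c≤d

all-mono : ∀ {I : Set} (is : List I) {p q : I → Bool} → (∀ i → p i Bool.≤ q i) →
           all p is Bool.≤ all q is
all-mono []       p≤q = b≤b
all-mono (i ∷ is) p≤q = ∧-mono (p≤q i) (all-mono is p≤q)

-- The computed assignment

module Algorithm (𝓑 : FiniteBüchiAlgebra) {V : Set}
                 (vertices : List V) (∈-vertices : ∀ x → x ∈ vertices)
                 (𝒮 : V → BüchiAlgebra.M*.Carrier (FiniteBüchiAlgebra.büchiAlgebra 𝓑) ⟨ V ⟩) where
  open FiniteBüchiAlgebra 𝓑
  open Listed vertices ∈-vertices
  module F* = FiniteSetoid (Poset.Eq.setoid M*.poset) finite*
  module J* = Joins 𝓜*
  module Jω = Joins 𝓜≤ω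
  module Lfp* = LeastFixedPoint M*.poset finite* M*.⊥ M*.minimum
                    index (lookup vertices) lookup-index
  module LfpBool = LeastFixedPoint Boolₚ.≤-poset (2 , Finₚ.2↔Bool) false Boolₚ.≤-minimum
                       index (lookup vertices) lookup-index

  IsLeftUnit : M*.Carrier → Set
  IsLeftUnit e = ∀ i → e · F*.to i M*.≈ F*.to i

  leftUnit? : Dec (∃[ i ] IsLeftUnit (F*.to i))
  leftUnit? = Finₚ.any? λ i → Finₚ.all? λ j → F*.to i · F*.to j F*.≟ F*.to j

  -- In a Büchi abstraction α* {ε} is a two-sided unit, hence the only left unit.
  unit : M*.Carrier
  unit with leftUnit?
  ... | yes (i , _) = F*.to i
  ... | no _        = M*.⊥

  weight : V → V → M*.Carrier
  weight δ δ₁ = fromMaybe M*.⊥ (𝒮 δ δ₁)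

  infix 4 _≤?_
  _≤?_ : Decidable M*._≤_
  _≤?_ = J*._≤?_ finite*

  -- An undefined entry is never silent, although γ* ⊥ may contain ε.
  silent : V → V → Bool
  silent δ δ₁ = Maybe.maybe (λ a → does (unit ≤? a)) false (𝒮 δ δ₁)

  start : ∀ {δ δ′ : V} → Dec (δ ≡ δ′) → M*.Carrier
  start (yes _) = unit
  start (no _)  = M*.⊥

  pathStep : V → (V → M*.Carrier) → V → M*.Carrier
  pathStep δ′ x δ =
    start (δ ≟ δ′) M*.∨ J*.⋁ vertices λ δ₁ → weight δ δ₁ · x δ₁

  pathStep-mono : ∀ δ′ {x y} → x Lfp*.≤̇ y → pathStep δ′ x Lfp*.≤̇ pathStep δ′ y
  pathStep-mono δ′ x≤y δ =
    J*.∨-mono M*.refl (J*.⋁-mono vertices λ δ₁ → ·-mono M*.refl (x≤y δ₁))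

  paths : V → V → M*.Carrier
  paths δ′ = Lfp*.lfp (pathStep δ′) (pathStep-mono δ′)

  loops : V → M*.Carrier
  loops δ = J*.⋁ vertices λ δ₁ → weight δ δ₁ · paths δ δ₁

  haltStep : (V → Bool) → V → Bool
  haltStep h δ = all (λ δ₁ → not (silent δ δ₁) Bool.∨ h δ₁) vertices

  haltStep-mono : ∀ {h h′} → h LfpBool.≤̇ h′ → haltStep h LfpBool.≤̇ haltStep h′
  haltStep-mono h≤h′ δ = all-mono vertices λ δ₁ → ∨-monoʳ (not (silent δ δ₁)) (h≤h′ δ₁)

  -- The unknowns from which every sequence of silent calls is finite.
  halts : V → Bool
  halts = LfpBool.lfp haltStep haltStep-mono

  divergence : V → Mω.Carrier
  divergence δ = Bool.if halts δ then Mω.⊥ else Jω.top finite≤ω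

  η𝔄 : V → Mω.Carrier
  η𝔄 δ = Jω.⋁ vertices λ δ′ →
    paths δ′ δ ·ω loops δ′ ^ω Mω.∨ paths δ′ δ ·ω divergence δ′

-- Languages of paths and runs

module PathLanguages {A V : Set} (U : V → V → Lang* A) where
  open Words {A}

  data Path (z : V) : V → Lang* A where
    nil  : Path z z []
    cons : ∀ {x y u v} → U x y u → Path z y v → Path z x (u ++ v)

  Loop : V → Lang* A
  Loop z w = ∃[ y ] (U z y ·ˡ Path z y) w

  path-trans : ∀ {x y z u v} → Path y x u → Path z y v → Path z x (u ++ v)
  path-trans nil q = q
  path-trans {v = v} (cons {u = u} {v = u′} e p) q =
    ≡.subst (Path _ _) (≡.sym (++-assoc u u′ v)) (cons e (path-trans p q))

  nonempty⇒loop : ∀ {z w} → Path z z w → 0 ℕ.< length w → Loop z w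
  nonempty⇒loop (cons {y = y} {u} {v} e p) _ = y , u , v , e , p , refl

  univ : Lang≤ω A
  univ = lang (λ _ → ⊤) _

  -- Alive z stands for: z can produce ε for ever.
  module _ (Alive : V → Set) where

    data Behaviour (x : V) (w : Σ≤ω A) : Set where
      cycling   : ∀ z → w ∈ʷ Path z x ·ʷ Loop z ^ωˡ → Behaviour x w
      diverging : ∀ z → Alive z → w ∈ʷ Path z x ·ʷ univ → Behaviour x w

    behaviour : V → Lang≤ω A
    behaviour x = lang (Behaviour x) λ where
      w≈ (cycling z w∈)     → cycling z (resp (Path z x ·ʷ Loop z ^ωˡ) w≈ w∈)
      w≈ (diverging z a w∈) → diverging z a (resp (Path z x ·ʷ univ) w≈ w∈)

    prepend : ∀ {x y w z} (L : Lang≤ω A) u v → U x y u → v ∈ʷ Path z y ·ʷ L → w ≈ʷ u ++ʷ v →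
              w ∈ʷ Path z x ·ʷ L
    prepend L u v u∈ (p , t , p∈ , t∈ , v≈) w≈ =
      u ++ p , t , cons u∈ p∈ , t∈ ,
      ≈ʷ-trans w≈ (≈ʷ-trans (++ʷ-cong u v≈) (≈ʷ-sym (++ʷ-assoc u p t)))

    behaviour-fold : ∀ {x y w} → w ∈ʷ U x y ·ʷ behaviour y → w ∈ʷ behaviour x
    behaviour-fold (u , v , u∈ , cycling z v∈ , w≈) =
      cycling z (prepend (Loop z ^ωˡ) u v u∈ v∈ w≈)
    behaviour-fold (u , v , u∈ , diverging z a v∈ , w≈) =
      diverging z a (prepend univ u v u∈ v∈ w≈)

    split : ∀ {x y w} u v t → U x y u → w ≈ʷ (u ++ v) ++ʷ t →
            v ++ʷ t ∈ʷ behaviour y → ∃[ y ] w ∈ʷ U x y ·ʷ behaviour y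
    split {y = y} u v t u∈ w≈ vt∈ =
      y , u , v ++ʷ t , u∈ , vt∈ , ≈ʷ-trans w≈ (++ʷ-assoc u v t)

    behaviour-unfold : (∀ {x} → Alive x → ∃[ y ] U x y [] × Alive y) →
      ∀ {x w} → w ∈ʷ behaviour x → ∃[ y ] w ∈ʷ U x y ·ʷ behaviour y
    behaviour-unfold alive (cycling z (_ , t , cons {u = u} {v} u∈ p∈ , t∈ , w≈)) =
      split u v t u∈ w≈ (cycling z (v , t , p∈ , t∈ , ≈ʷ-refl))
    behaviour-unfold alive (diverging z a (_ , t , cons {u = u} {v} u∈ p∈ , t∈ , w≈)) =
      split u v t u∈ w≈ (diverging z a (v , t , p∈ , t∈ , ≈ʷ-refl))
    behaviour-unfold alive (diverging z a (_ , t , nil , _ , w≈)) with alive a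
    ... | y , ε∈ , a′ = split [] [] t ε∈ w≈ (diverging y a′ (_ , _ , nil , _ , ≈ʷ-refl))
    behaviour-unfold alive (cycling z (_ , t , nil , (us , us∈ , prod) , w≈))
      with us 0 | us∈ 0 | infiniteProduct-tail us prod
    ... | _ | y , u , v , u∈ , v∈ , refl | t′ , t≈ , prod′ =
      split u v t′ u∈ (≈ʷ-trans w≈ (≈ʷ-trans ([]-++ʷ t) t≈))
        (cycling z (v , t′ , v∈ , (us ∘ suc , us∈ ∘ suc , prod′) , ≈ʷ-refl))

    module _ (em : ExcludedMiddle 0ℓ) (vertices : List V) (∈-vertices : ∀ x → x ∈ vertices) where

      frequently : (Q : ℕ → Set) →
        (∃[ N ] ∀ n → N ℕ.≤ n → ¬ Q n) ⊎ (∀ N → ∃[ n ] N ℕ.≤ n × Q n)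
      frequently Q with em {∃[ N ] ∀ n → N ℕ.≤ n → ¬ Q n}
      ... | yes eventually¬ = inj₁ eventually¬
      ... | no ¬eventually¬ = inj₂ often
        where
        often : ∀ N → ∃[ n ] N ℕ.≤ n × Q n
        often N with em {∃[ n ] N ℕ.≤ n × Q n}
        ... | yes found = found
        ... | no ¬found =
          contradiction (N , λ n N≤n q → ¬found (n , N≤n , q)) ¬eventually¬

      recurrent-vertex : (xs : ℕ → V) → ∃[ z ] ∀ N → ∃[ n ] N ℕ.≤ n × xs n ≡ z
      recurrent-vertex xs with search vertices
        where
        search : ∀ vs → (∃[ N ] ∀ n → N ℕ.≤ n → xs n ∉ vs) ⊎
                        (∃[ z ] ∀ N → ∃[ n ] N ℕ.≤ n × xs n ≡ z)
        search []       = inj₁ (0 , λ n _ ())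
        search (v ∷ vs) with search vs | frequently (λ n → xs n ≡ v)
        ... | inj₂ found    | _          = inj₂ found
        ... | inj₁ _        | inj₂ often = inj₂ (v , often)
        ... | inj₁ (N , ∉vs) | inj₁ (N′ , ≢v) = inj₁ (N ⊔ N′ , λ where
          n le (here eq)  → ≢v n (ℕₚ.m⊔n≤o⇒n≤o N N′ le) eq
          n le (there i∈) → ∉vs n (ℕₚ.m⊔n≤o⇒m≤o N N′ le) i∈)
      ... | inj₁ (N , ∉) = contradiction (∈-vertices (xs N)) (∉ N ℕₚ.≤-refl)
      ... | inj₂ found   = found

      module _ (silent⇒alive : (xs : ℕ → V) → (∀ n → U (xs n) (xs (suc n)) []) → Alive (xs 0))
        (xs : ℕ → V) (us : ℕ → List A) (ws : ℕ → Σ≤ω A)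
        (us∈ : ∀ n → U (xs n) (xs (suc n)) (us n))
        (step : ∀ n → ws n ≈ʷ us n ++ʷ ws (suc n)) where

        Segment : ℕ → ℕ → List A → Set
        Segment m n v = Path (xs n) (xs m) v × ws m ≈ʷ v ++ʷ ws n

        segment-trans : ∀ {l m n u v} → Segment l m u → Segment m n v → Segment l n (u ++ v)
        segment-trans {u = u} {v} (p , eq) (q , eq′) =
          path-trans p q , ≈ʷ-trans eq (≈ʷ-trans (++ʷ-cong u eq′) (≈ʷ-sym (++ʷ-assoc u v _)))

        segment-step : ∀ n → Segment n (suc n) (us n ++ [])
        segment-step n = cons (us∈ n) nil ,
          ≈ʷ-trans (step n)
            (≈ʷ-trans (++ʷ-cong (us n) (≈ʷ-sym ([]-++ʷ _))) (≈ʷ-sym (++ʷ-assoc (us n) [] _)))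

        segment‴ : ∀ {m n} → m ≤‴ n → ∃[ v ] Segment m n v
        segment‴ ≤‴-refl      = [] , nil , ≈ʷ-sym ([]-++ʷ _)
        segment‴ (≤‴-step m<n) = _ , segment-trans (segment-step _) (proj₂ (segment‴ m<n))

        segment : ∀ {m n} → m ℕ.≤ n → ∃[ v ] Segment m n v
        segment = segment‴ ∘ ℕₚ.≤⇒≤‴

        module Recurrent (z : V) (recurs : ∀ N → ∃[ n ] N ℕ.≤ n × xs n ≡ z)
                         (productive : ∀ N → ∃[ n ] N ℕ.≤ n × us n ≢ []) where

          Visit : Set
          Visit = ∃[ n ] xs n ≡ z

          record Cycle (i : Visit) : Set where
            field
              target   : Visit
              label    : List A
              isLoop   : Loop z label
              nonempty : 0 ℕ.< length label
              factor   : ws (proj₁ i) ≈ʷ label ++ʷ ws (proj₁ target)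

          0<length : ∀ (u v v′ : List A) → v ≢ [] → 0 ℕ.< length (u ++ ((v ++ []) ++ v′))
          0<length []      []      v′ v≢[] = contradiction refl v≢[]
          0<length []      (_ ∷ _) v′ v≢[] = s≤s z≤n
          0<length (_ ∷ _) v       v′ v≢[] = s≤s z≤n

          cycle : ∀ i → Cycle i
          cycle (n , eq) with productive n
          ... | m , n≤m , um≢[] with recurs (suc m)
          ... | l , m<l , eq′ with segment n≤m | segment m<l
          ... | u , seg | v , seg′ = record
            { target = l , eq′
            ; label = w
            ; isLoop = nonempty⇒loop (≡.subst₂ (λ y x → Path y x w) eq′ eq (proj₁ whole)) 0<w
            ; nonempty = 0<w
            ; factor = proj₂ whole }
            where
            w : List A
            w = u ++ ((us m ++ []) ++ v)
            0<w : 0 ℕ.< length w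
            0<w = 0<length u (us m) v um≢[]
            whole : Segment n l w
            whole = segment-trans seg (segment-trans (segment-step m) seg′)

          first : ∃[ n ] 0 ℕ.≤ n × xs n ≡ z
          first = recurs 0

          visits : ℕ → Visit
          visits zero    = proj₁ first , proj₂ (proj₂ first)
          visits (suc n) = Cycle.target (cycle (visits n))

          cyclic : ws 0 ∈ʷ behaviour (xs 0)
          cyclic with segment (proj₁ (proj₂ first))
          ... | v , p , w≈ = cycling z
            (v , ws (proj₁ first) , ≡.subst (λ y → Path y (xs 0) v) (proj₂ (proj₂ first)) p ,
             ( Cycle.label ∘ cycle ∘ visits
             , Cycle.isLoop ∘ cycle ∘ visits
             , isInfiniteProduct (Cycle.label ∘ cycle ∘ visits) (ws ∘ proj₁ ∘ visits)
                 (Cycle.factor ∘ cycle ∘ visits) (Cycle.nonempty ∘ cycle ∘ visits)) ,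
             w≈)

        ¬¬[]⇒[] : ∀ {u : List A} → ¬ (u ≢ []) → u ≡ []
        ¬¬[]⇒[] {[]}    _  = refl
        ¬¬[]⇒[] {_ ∷ _} nn = contradiction (λ ()) nn

        run-behaviour : ws 0 ∈ʷ behaviour (xs 0)
        run-behaviour with frequently (λ n → us n ≢ [])
        ... | inj₂ productive with recurrent-vertex xs
        ... | z , recurs = Recurrent.cyclic z recurs productive
        run-behaviour | inj₁ (N , finished) with segment (z≤n {N})
        ... | v , p , w≈ = diverging (xs N) aliveN (v , ws N , p , _ , w≈)
          where
          aliveN : Alive (xs N)
          aliveN = silent⇒alive (λ n → xs (n + N)) λ n →
            ≡.subst (U (xs (n + N)) (xs (suc (n + N))))
              (¬¬[]⇒[] (finished (n + N) (ℕₚ.m≤n+m N n))) (us∈ (n + N))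

-- Correctness

module GaloisConnection {a₁ a₂ a₃ c₁ c₂ c₃} {𝒜 : Poset a₁ a₂ a₃} {𝒞 : Poset c₁ c₂ c₃}
                        (insertion : GaloisInsertion 𝒜 𝒞) where
  open GaloisInsertion insertion
  private
    module 𝒜 = Poset 𝒜
    module 𝒞 = Poset 𝒞

  ⊑γ⇒α⊑ : ∀ {x y} → y 𝒞.≤ γ x → α y 𝒜.≤ x
  ⊑γ⇒α⊑ {x} y≤ = 𝒜.trans (α-mono y≤) (𝒜.reflexive (α∘γ x))

  α⊑⇒⊑γ : ∀ {x y} → α y 𝒜.≤ x → y 𝒞.≤ γ x
  α⊑⇒⊑γ {y = y} α≤ = 𝒞.trans (γ∘α y) (γ-mono α≤)

all≡false⁺ : ∀ {I : Set} {is : List I} (p : I → Bool) {i} → i ∈ is → p i ≡ false → all p is ≡ false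
all≡false⁺ {is = _ ∷ is} p (here refl) eq = cong (Bool._∧ all p is) eq
all≡false⁺ {is = j ∷ _}  p (there i∈)  eq =
  ≡.trans (cong (p j Bool.∧_) (all≡false⁺ p i∈ eq)) (Boolₚ.∧-zeroʳ (p j))

all≡false⁻ : ∀ {I : Set} (is : List I) (p : I → Bool) → all p is ≡ false → ∃[ i ] p i ≡ false
all≡false⁻ (i ∷ is) p eq with p i in pi
... | false = i , pi
... | true  = all≡false⁻ is p eq

module Correctness {A : Set} (𝓑 : FiniteBüchiAlgebra) (𝔟 : BüchiAbstraction A 𝓑) {V : Set}
                   (vertices : List V) (∈-vertices : ∀ x → x ∈ vertices)
                   (𝒮 : V → BüchiAlgebra.M*.Carrier (FiniteBüchiAlgebra.büchiAlgebra 𝓑) ⟨ V ⟩) where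
  open FiniteBüchiAlgebra 𝓑
  open BüchiAbstraction 𝔟
  open Listed vertices ∈-vertices
  open Algorithm 𝓑 vertices ∈-vertices 𝒮
  open GaloisInsertion insertion* using () renaming (α-mono to α*-mono; α∘γ to α*∘γ*)
  open GaloisInsertion insertion≤ω using () renaming (α-mono to α≤ω-mono; α∘γ to α≤ω∘γ≤ω)
  open GaloisConnection insertion* using () renaming (⊑γ⇒α⊑ to ⊆γ*⇒α*≤; α⊑⇒⊑γ to α*≤⇒⊆γ*)
  open GaloisConnection insertion≤ω using () renaming (⊑γ⇒α⊑ to ⊆γ≤ω⇒α≤ω≤; α⊑⇒⊑γ to α≤ω≤⇒⊆γ≤ω)

  ε : Lang* A
  ε w = w ≡ []

  α*-cong : ∀ {V W} → (∀ {w} → V w → W w) → (∀ {w} → W w → V w) → α* V M*.≈ α* W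
  α*-cong V⊆W W⊆V = M*.antisym (α*-mono V⊆W) (α*-mono W⊆V)

  ·-cong : ∀ {x x′ y y′} → x M*.≈ x′ → y M*.≈ y′ → x · y M*.≈ x′ · y′
  ·-cong x≈ y≈ = M*.antisym
    (·-mono (M*.reflexive x≈) (M*.reflexive y≈))
    (·-mono (M*.reflexive (M*.Eq.sym x≈)) (M*.reflexive (M*.Eq.sym y≈)))

  α*ε-identityˡ : ∀ x → α* ε · x M*.≈ x
  α*ε-identityˡ x =
    M*.Eq.trans (·-cong M*.Eq.refl (M*.Eq.sym (α*∘γ* x)))
    (M*.Eq.trans (M*.Eq.sym (α*-· ε (γ* x)))
    (M*.Eq.trans (α*-cong (λ { (_ , _ , refl , v∈ , refl) → v∈ })
                          (λ {w} w∈ → [] , w , refl , w∈ , refl))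
    (α*∘γ* x)))

  α*ε-identityʳ : ∀ x → x · α* ε M*.≈ x
  α*ε-identityʳ x =
    M*.Eq.trans (·-cong (M*.Eq.sym (α*∘γ* x)) M*.Eq.refl)
    (M*.Eq.trans (M*.Eq.sym (α*-· (γ* x) ε))
    (M*.Eq.trans (α*-cong
        (λ { (u , _ , u∈ , refl , refl) → ≡.subst (γ* x) (≡.sym (++-identityʳ u)) u∈ })
        (λ {w} w∈ → w , [] , w∈ , refl , ≡.sym (++-identityʳ w)))
    (α*∘γ* x)))

  unit≈α*ε : unit M*.≈ α* ε
  unit≈α*ε with leftUnit?
  ... | yes (i , leftUnit) =
    M*.Eq.trans (M*.Eq.sym (α*ε-identityʳ (F*.to i)))
    (M*.Eq.trans (·-cong M*.Eq.refl (M*.Eq.sym (F*.to∘from (α* ε))))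
    (M*.Eq.trans (leftUnit (F*.from (α* ε))) (F*.to∘from (α* ε))))
  ... | no ¬leftUnit = contradiction
    (F*.from (α* ε) , λ j →
      M*.Eq.trans (·-cong (F*.to∘from (α* ε)) M*.Eq.refl) (α*ε-identityˡ (F*.to j)))
    ¬leftUnit

  unit≤⇒ε∈ : ∀ {x} → unit M*.≤ x → γ* x []
  unit≤⇒ε∈ unit≤ = α*≤⇒⊆γ* (M*.trans (M*.reflexive (M*.Eq.sym unit≈α*ε)) unit≤) refl

  ε∈⇒unit≤ : ∀ {x} → γ* x [] → unit M*.≤ x
  ε∈⇒unit≤ ε∈ = M*.trans (M*.reflexive unit≈α*ε) (⊆γ*⇒α*≤ λ { refl → ε∈ })

  entries : V → V → Lang* A
  entries δ δ₁ = fromMaybe ∅ (Maybe.map γ* (𝒮 δ δ₁))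

  open PathLanguages entries

  α*-fromMaybe : ∀ a → α* (fromMaybe ∅ (Maybe.map γ* a)) M*.≈ fromMaybe M*.⊥ a
  α*-fromMaybe (just a) = α*∘γ* a
  α*-fromMaybe nothing  = M*.antisym (⊆γ*⇒α*≤ λ ()) (M*.minimum _)

  α*-entries-· : ∀ {δ δ₁ V x} → α* V M*.≈ x → α* (entries δ δ₁ ·ˡ V) M*.≈ weight δ δ₁ · x
  α*-entries-· {δ} {δ₁} {V} α*V≈x =
    M*.Eq.trans (α*-· (entries δ δ₁) V) (·-cong (α*-fromMaybe (𝒮 δ δ₁)) α*V≈x)

  silent⁻ : ∀ {δ δ₁} → silent δ δ₁ ≡ true → entries δ δ₁ []
  silent⁻ {δ} {δ₁} s with 𝒮 δ δ₁
  ... | just a = unit≤⇒ε∈ (invert (≡.subst (Reflects _) s (proof (unit ≤? a))))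

  silent⁺ : ∀ {δ δ₁} → entries δ δ₁ [] → silent δ δ₁ ≡ true
  silent⁺ {δ} {δ₁} ε∈ with 𝒮 δ δ₁
  ... | just a = dec-true (unit ≤? a) (ε∈⇒unit≤ ε∈)

  unit≤paths : ∀ δ → unit M*.≤ paths δ δ
  unit≤paths δ = M*.trans unit≤step (Lfp*.lfp-prefixed (pathStep δ) (pathStep-mono δ) δ)
    where
    unit≤step : unit M*.≤ pathStep δ (paths δ) δ
    unit≤start : (eq? : Dec (δ ≡ δ)) → unit M*.≤ start eq?
    unit≤start (yes _)  = M*.refl
    unit≤start (no δ≢δ) = contradiction refl δ≢δ
    unit≤step = M*.trans (unit≤start (δ ≟ δ)) (M*.x≤x∨y _ _)

  weight·paths≤paths : ∀ δ′ δ δ₁ → weight δ δ₁ · paths δ′ δ₁ M*.≤ paths δ′ δ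
  weight·paths≤paths δ′ δ δ₁ =
    M*.trans (J*.⋁-upper (λ δ₁ → weight δ δ₁ · paths δ′ δ₁) (∈-vertices δ₁))
    (M*.trans (M*.y≤x∨y _ _)
    (Lfp*.lfp-prefixed (pathStep δ′) (pathStep-mono δ′) δ))

  Path⊆γ*paths : ∀ {δ′ δ w} → Path δ′ δ w → γ* (paths δ′ δ) w
  Path⊆γ*paths {δ′} nil = unit≤⇒ε∈ (unit≤paths δ′)
  Path⊆γ*paths {δ′} {δ} (cons {y = δ₁} u∈ p) =
    α*≤⇒⊆γ*
      (M*.trans (M*.reflexive (α*-entries-· (α*∘γ* (paths δ′ δ₁)))) (weight·paths≤paths δ′ δ δ₁))
      (_ , _ , u∈ , Path⊆γ*paths p , refl)

  paths≤α*Path : ∀ δ′ δ → paths δ′ δ M*.≤ α* (Path δ′ δ)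
  paths≤α*Path δ′ = Lfp*.lfp-least (pathStep δ′) (pathStep-mono δ′) λ δ →
    M*.∨-least (start≤ (δ ≟ δ′)) (J*.⋁-least vertices _ λ δ₁ →
      M*.trans (M*.reflexive (M*.Eq.sym (α*-entries-· {δ} {δ₁} M*.Eq.refl)))
        (α*-mono λ { (_ , _ , u∈ , p , refl) → cons u∈ p }))
    where
    start≤ : ∀ {δ} (eq? : Dec (δ ≡ δ′)) → start eq? M*.≤ α* (Path δ′ δ)
    start≤ (yes refl) = M*.trans (M*.reflexive unit≈α*ε) (α*-mono λ { refl → nil })
    start≤ (no _)     = M*.minimum _

  α*Path≈paths : ∀ δ′ δ → α* (Path δ′ δ) M*.≈ paths δ′ δ
  α*Path≈paths δ′ δ = M*.antisym (⊆γ*⇒α*≤ Path⊆γ*paths) (paths≤α*Path δ′ δ)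

  α*Loop≈loops : ∀ δ → α* (Loop δ) M*.≈ loops δ
  α*Loop≈loops δ = M*.antisym
    (⊆γ*⇒α*≤ λ { (δ₁ , w∈) → α*≤⇒⊆γ*
      (M*.trans (M*.reflexive (α*-step δ₁)) (J*.⋁-upper _ (∈-vertices δ₁))) w∈ })
    (J*.⋁-least vertices _ λ δ₁ →
      M*.trans (M*.reflexive (M*.Eq.sym (α*-step δ₁))) (α*-mono (δ₁ ,_)))
    where
    α*-step : ∀ δ₁ → α* (entries δ δ₁ ·ˡ Path δ δ₁) M*.≈ weight δ δ₁ · paths δ δ₁
    α*-step δ₁ = α*-entries-· (α*Path≈paths δ δ₁)

  Alive : V → Set
  Alive δ = halts δ ≡ false

  alive-step : ∀ {δ} → Alive δ → ∃[ δ₁ ] entries δ δ₁ [] × Alive δ₁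
  alive-step {δ} alive =
    δ₁ , silent⁻ (Boolₚ.not-injective (Boolₚ.∨-conicalˡ _ _ eq)) , Boolₚ.∨-conicalʳ _ _ eq
    where
    step≡false : haltStep halts δ ≡ false
    step≡false = Boolₚ.≤-antisym
      (≡.subst (haltStep halts δ Bool.≤_) alive (LfpBool.lfp-prefixed haltStep haltStep-mono δ))
      (Boolₚ.≤-minimum _)
    found = all≡false⁻ vertices (λ δ₁ → not (silent δ δ₁) Bool.∨ halts δ₁) step≡false
    δ₁ = proj₁ found
    eq = proj₂ found

  silent⇒alive : (δs : ℕ → V) → (∀ n → entries (δs n) (δs (suc n)) []) → Alive (δs 0)
  silent⇒alive δs ε∈ = unhalted (2 ^ length vertices) 0
    where
    unhalted : ∀ k n → LfpBool.iterate haltStep haltStep-mono k (δs n) ≡ false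
    unhalted zero    n = refl
    unhalted (suc k) n = all≡false⁺ _ (∈-vertices (δs (suc n)))
      (≡.cong₂ (λ s h → not s Bool.∨ h) (silent⁺ (ε∈ n)) (unhalted k (suc n)))

  β : V → Lang≤ω A
  β = behaviour Alive

  ·ω-cong : ∀ {x x′ y y′} → x M*.≈ x′ → y Mω.≈ y′ → x ·ω y Mω.≈ x′ ·ω y′
  ·ω-cong x≈ y≈ = Mω.antisym
    (·ω-mono (M*.reflexive x≈) (Mω.reflexive y≈))
    (·ω-mono (M*.reflexive (M*.Eq.sym x≈)) (Mω.reflexive (Mω.Eq.sym y≈)))

  ^ω-cong : ∀ {x y} → x M*.≈ y → x ^ω Mω.≈ y ^ω
  ^ω-cong x≈y = Mω.antisym
    (^ω-mono (M*.reflexive x≈y)) (^ω-mono (M*.reflexive (M*.Eq.sym x≈y)))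

  α-Path· : ∀ δ′ δ {V x} → α≤ω V Mω.≈ x → α≤ω (Path δ′ δ ·ʷ V) Mω.≈ paths δ′ δ ·ω x
  α-Path· δ′ δ {V} α≈ =
    Mω.Eq.trans (α≤ω-· (Path δ′ δ) V) (·ω-cong (α*Path≈paths δ′ δ) α≈)

  α-Loop^ω : ∀ δ → α≤ω (Loop δ ^ωˡ) Mω.≈ loops δ ^ω
  α-Loop^ω δ = Mω.Eq.trans (α≤ω-^ω (Loop δ)) (^ω-cong (α*Loop≈loops δ))

  divergenceLang : V → Lang≤ω A
  divergenceLang δ = lang (λ _ → Alive δ) (λ _ alive → alive)

  α-divergence : ∀ δ → α≤ω (divergenceLang δ) Mω.≈ divergence δ
  α-divergence δ with halts δ
  ... | true  = Mω.antisym (⊆γ≤ω⇒α≤ω≤ λ ()) (Mω.minimum _)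
  ... | false = Mω.antisym (Jω.top-maximum finite≤ω _)
    (Mω.trans (Mω.reflexive (Mω.Eq.sym (α≤ω∘γ≤ω _))) (α≤ω-mono λ _ → refl))

  η𝔄≈α≤ωβ : ∀ δ → η𝔄 δ Mω.≈ α≤ω (β δ)
  η𝔄≈α≤ωβ δ = Mω.antisym
    (Jω.⋁-least vertices _ λ δ′ → Mω.∨-least
      (Mω.trans (Mω.reflexive (Mω.Eq.sym (α-Path· δ′ δ (α-Loop^ω δ′))))
        (α≤ω-mono (cycling δ′)))
      (Mω.trans (Mω.reflexive (Mω.Eq.sym (α-Path· δ′ δ (α-divergence δ′))))
        (α≤ω-mono λ { (u , v , u∈ , alive , eq) → diverging δ′ alive (u , v , u∈ , _ , eq) })))
    (⊆γ≤ω⇒α≤ω≤ λ where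
      (cycling δ′ w∈) → α≤ω≤⇒⊆γ≤ω
        (Mω.trans (Mω.reflexive (α-Path· δ′ δ (α-Loop^ω δ′)))
        (Mω.trans (Mω.x≤x∨y _ _) (Jω.⋁-upper _ (∈-vertices δ′)))) w∈
      (diverging δ′ alive (u , v , u∈ , _ , eq)) → α≤ω≤⇒⊆γ≤ω
        (Mω.trans (Mω.reflexive (α-Path· δ′ δ (α-divergence δ′)))
        (Mω.trans (Mω.y≤x∨y _ _) (Jω.⋁-upper _ (∈-vertices δ′)))) (u , v , u∈ , alive , eq))

module Enumeration (P : Program) where
  open Program P
  open Signatures P

  regions : List Reg
  regions = Null ∷ Unknown ∷ map CreatedAt (allFin #labels)

  ∈-regions : ∀ r → r ∈ regions
  ∈-regions Null          = here refl
  ∈-regions (CreatedAt ℓ) = there (there (∈-map⁺ CreatedAt (∈-allFin ℓ)))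
  ∈-regions Unknown       = there (here refl)

  argLists : ℕ → List (List Reg)
  argLists zero    = [ [] ]
  argLists (suc n) = cartesianProductWith _∷_ regions (argLists n)

  ∈-argLists : ∀ s → s ∈ argLists (length s)
  ∈-argLists []      = here refl
  ∈-argLists (r ∷ s) = ∈-cartesianProductWith⁺ _∷_ (∈-regions r) (∈-argLists s)

  sigs : Cls → Reg → Mtd → List Reg → List Sig
  sigs C r m s with m Subsetₚ.∈? methods C | length s ℕₚ.≟ arity C m
  ... | yes m∈C | yes len = [ sig C r m s m∈C len ]
  ... | _       | _       = []

  ∈-sigs : ∀ δ → let open Sig δ in δ ∈ sigs cls region mtd args
  ∈-sigs (sig C r m s m∈C len)
    with m Subsetₚ.∈? methods C | length s ℕₚ.≟ arity C m
  ... | yes _  | yes _   = here refl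
  ... | yes _  | no len≢ = contradiction (recompute (length s ℕₚ.≟ arity C m) len) len≢
  ... | no m∉C | _       = contradiction (recompute (m Subsetₚ.∈? methods C) m∈C) m∉C

  sigsOfMethod : Cls → Reg → Mtd → List Sig
  sigsOfMethod C r m = concatMap (sigs C r m) (argLists (arity C m))

  sigsOfReceiver : Cls → Reg → List Sig
  sigsOfReceiver C r = concatMap (sigsOfMethod C r) (allFin #methods)

  sigsOfClass : Cls → List Sig
  sigsOfClass C = concatMap (sigsOfReceiver C) regions

  allSigs : List Sig
  allSigs = concatMap sigsOfClass (allFin #classes)

  ∈-allSigs : ∀ δ → δ ∈ allSigs
  ∈-allSigs δ@(sig C r m s _ len) =
    ∈-concatMap⁺ sigsOfClass        (lose (∈-allFin C)
    (∈-concatMap⁺ (sigsOfReceiver C) (lose (∈-regions r)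
    (∈-concatMap⁺ (sigsOfMethod C r) (lose (∈-allFin m)
    (∈-concatMap⁺ (sigs C r m)       (lose s∈ (∈-sigs δ))))))))
    where
    s∈ : s ∈ argLists (arity C m)
    s∈ = ≡.subst (λ n → s ∈ argLists n)
           (recompute (length s ℕₚ.≟ arity C m) len) (∈-argLists s)

module InfinitaryEffect (P : Program) {A : Set} (𝓑 : FiniteBüchiAlgebra)
                        (𝔟 : BüchiAbstraction A 𝓑) (M : Typing.BüchiMethodTyping P 𝓑) where
  open Signatures P
  open Typing P
  open FiniteBüchiAlgebra 𝓑 using (module Mω)
  open BüchiAbstraction 𝔟
  open Enumeration P

  callExpressions : Sig → BüchiAlgebra.M*.Carrier (FiniteBüchiAlgebra.büchiAlgebra 𝓑) ⟨ Sig ⟩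
  callExpressions δ = proj₂ (BüchiMethodTyping.typing M δ)

  open Words {A}
  open Algorithm 𝓑 allSigs ∈-allSigs callExpressions using (η𝔄)
  open Correctness 𝓑 𝔟 allSigs ∈-allSigs callExpressions
  open PathLanguages entries

  β-isSolution : IsSolution (concretize 𝔟 M) β
  β-isSolution δ = behaviour-unfold Alive alive-step , λ { (_ , w∈) → behaviour-fold Alive w∈ }

  solution⊆β : ExcludedMiddle 0ℓ → ∀ {η} → IsSolution (concretize 𝔟 M) η → ∀ δ → η δ ⊆ʷ β δ
  solution⊆β em {η} sol δ {w} w∈ =
    resp (β δ) (≈ʷ-sym ws₀) (≡.subst (λ δ → ws 0 ∈ʷ β δ) δs₀
      (run-behaviour Alive em allSigs ∈-allSigs silent⇒alive δs us ws us∈ steps))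
    where
    open Existence (concretize 𝔟 M)
    open Run (IsInfinitaryEffectTyping.isGreatest isInfinitaryEffectTyping η sol δ w∈)

  η𝔄-correct : ExcludedMiddle 0ℓ → ∀ {η} → IsInfinitaryEffectTyping (concretize 𝔟 M) η →
               ∀ δ → η𝔄 δ Mω.≈ α≤ω (η δ)
  η𝔄-correct em {η} isEffectTyping δ = Mω.Eq.trans (η𝔄≈α≤ωβ δ) (Mω.antisym
    (α≤ω-mono (isGreatest β β-isSolution δ))
    (α≤ω-mono (solution⊆β em {η} isSolution δ)))
    where
    open IsInfinitaryEffectTyping isEffectTyping
    open GaloisInsertion insertion≤ω using () renaming (α-mono to α≤ω-mono)

theorem5p8 :
  (P : Program) →
  let open Signatures P
      open Typing P
      open FiniteBüchiAlgebra
      open BüchiAbstraction in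
  Σ[ η𝔄 ∈ ((𝓑 : FiniteBüchiAlgebra) → BüchiMethodTyping 𝓑 → Sig → Mω.Carrier 𝓑) ]
    (ExcludedMiddle 0ℓ →
     (k : ℕ) (𝓑 : FiniteBüchiAlgebra) (𝔟 : BüchiAbstraction (Fin k) 𝓑)
     (𝔄 : Lang≤ω (Fin k)) → Faithful 𝔟 𝔄 →
     (M𝔄 : BüchiMethodTyping 𝓑)
     (ηγ : Sig → Lang≤ω (Fin k)) →
     IsInfinitaryEffectTyping (concretize 𝔟 M𝔄) ηγ →
     ∀ δ → Mω._≈_ 𝓑 (η𝔄 𝓑 M𝔄 δ) (α≤ω 𝔟 (ηγ δ)))
theorem5p8 P =
  (λ 𝓑 M → Algorithm.η𝔄 𝓑 allSigs ∈-allSigs (proj₂ ∘ Typing.BüchiMethodTyping.typing M)) ,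
  λ em k 𝓑 𝔟 𝔄 _ M ηγ → InfinitaryEffect.η𝔄-correct P 𝓑 𝔟 M em
  where open Enumeration P
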